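{- Let $\frac{a}{b}$ and $\frac{c}{d}$ be non-negative fractions in lowest terms (with $b,d>0$) satisfying $bc - ad = 1$. Then every rational number in the interval $\left[\frac{a}{b}, \frac{c}{d}\right]$ appears in the tree $T\left(\frac{a}{b}, \frac{c}{d}\right)$.
   Context: All fractions are written in lowest terms with positive denominator. The mediant of two reduced fractions $\frac{p}{q}$ and $\frac{r}{s}$ is the fraction $\frac{p+r}{q+s}$ put in lowest terms. Given two non-negative rational numbers $\frac{a}{b} < \frac{c}{d}$ in lowest terms, define finite sequences (rows) $S_n\left(\frac{a}{b},\frac{c}{d}\right)$, $n \ge 0$, of reduced fractions: $S_0 = \left(\frac{a}{b}, \frac{c}{d}\right)$, and $S_{n+1}$ is obtained from $S_n$ by copying all terms and inserting between every two consecutive terms their (reduced) mediant, where the mediant is computed from the reduced forms of the two terms. The tree $T\left(\frac{a}{b},\frac{c}{d}\right)$ is the collection of all the rows $S_n\left(\frac{a}{b},\frac{c}{d}\right)$, $n\ge 0$; a rational number appears in the tree if it is a term of some row. -}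

module Defs where

open import Data.Nat.Base as ℕ using (ℕ; zero; suc)
open import Data.Integer.Base as ℤ using ()
open import Data.Rational.Base using (ℚ; ↥_; ↧ₙ_; _/_)
open import Data.List.Base using (List; []; _∷_)
open import Data.List.Membership.Propositional using (_∈_)
open import Data.Product.Base using (∃-syntax)

-- Elements of ℚ are stored in lowest terms, so ↥ and ↧ₙ read off the reduced
-- form of each argument, and _/_ puts the result back in lowest terms.
mediant : ℚ → ℚ → ℚ
mediant p q = (↥ p ℤ.+ ↥ q) / (↧ₙ p ℕ.+ ↧ₙ q)

insertMediants : List ℚ → List ℚ
insertMediants []           = []
insertMediants (p ∷ [])     = p ∷ []
insertMediants (p ∷ q ∷ ps) = p ∷ mediant p q ∷ insertMediants (q ∷ ps)

row : ℚ → ℚ → ℕ → List ℚ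
row l r zero    = l ∷ r ∷ []
row l r (suc n) = insertMediants (row l r n)

-- The tree T(l , r) is the family of all its rows.
Tree : Set
Tree = ℕ → List ℚ

T : ℚ → ℚ → Tree
T l r = row l r

infix 4 _AppearsIn_

_AppearsIn_ : ℚ → Tree → Set
x AppearsIn t = ∃[ n ] x ∈ t n

{-# OPTIONS --safe #-}
-- Write det p q for the numerator of q − p over the product of the
-- denominators. If det p q = 1, the fraction (↥ p + ↥ q) / (↧ p + ↧ q) is
-- already reduced, so det is additive along mediants: with m the mediant of p
-- and q, det x m = det x p + det x q. Hence p, m and m, q again have
-- determinant 1, and replacing the interval [p , q] around x by the half that
-- contains x performs one subtractive Euclidean step on the pair of natural
-- numbers (det p x , det x q). When one of them vanishes, x is an endpoint.
module Submission where

open import Defs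
open import Data.Integer.Base as ℤ using (ℤ; +_; 0ℤ; 1ℤ; ∣_∣)
open import Data.Integer.GCD using (gcd)
import Data.Integer.Properties as ℤ
open import Data.Integer.Tactic.RingSolver using (solve-∀)
open import Data.List.Base using (List; []; _∷_)
open import Data.List.Membership.Propositional using (_∈_)
open import Data.List.Relation.Unary.Any as Any using ()
open import Data.Nat.Base as ℕ using (zero; suc)
open import Data.Nat.Induction using (<-wellFounded)
import Data.Nat.Properties as ℕ
open import Data.Product.Base using (_,_)
open import Data.Rational.Base using (ℚ; 0ℚ; _≤_; *≡*; ↥_; ↧_; ↧ₙ_)
open import Data.Rational.Properties using (↥-/; ↧-/; ≃⇒≡; drop-*≤*)
open import Data.Sum.Base using (inj₁; inj₂)
open import Induction.WellFounded using (Acc; acc)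
open import Relation.Binary.PropositionalEquality
  using (_≡_; refl; sym; trans; cong; cong₂; subst; module ≡-Reasoning)

-- Being consecutive is what the descent must remember: membership of both endpoints in a row would
-- not put their mediant in the next one.
data Adjacent {A : Set} (p q : A) : List A → Set where
  here  : ∀ {xs} → Adjacent p q (p ∷ q ∷ xs)
  there : ∀ {x xs} → Adjacent p q xs → Adjacent p q (x ∷ xs)

module _ {A : Set} {p q : A} where

  adjacent⇒∈ˡ : ∀ {xs} → Adjacent p q xs → p ∈ xs
  adjacent⇒∈ˡ here      = Any.here refl
  adjacent⇒∈ˡ (there a) = Any.there (adjacent⇒∈ˡ a)

  adjacent⇒∈ʳ : ∀ {xs} → Adjacent p q xs → q ∈ xs
  adjacent⇒∈ʳ here      = Any.there (Any.here refl)
  adjacent⇒∈ʳ (there a) = Any.there (adjacent⇒∈ʳ a)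

module _ {p q : ℚ} where

  insertMediants-adjacentˡ : ∀ {xs} → Adjacent p q xs →
    Adjacent p (mediant p q) (insertMediants xs)
  insertMediants-adjacentˡ here                = here
  -- Splitting `a` exposes two leading terms, so that `insertMediants` computes; the two `there`s
  -- pass the head and the mediant inserted after it.
  insertMediants-adjacentˡ (there a@here)      = there (there (insertMediants-adjacentˡ a))
  insertMediants-adjacentˡ (there a@(there _)) = there (there (insertMediants-adjacentˡ a))

  insertMediants-adjacentʳ : ∀ {xs} → Adjacent p q xs →
    Adjacent (mediant p q) q (insertMediants xs)
  -- The shape of the tail decides which clause of `insertMediants` brings `q` to the front.
  insertMediants-adjacentʳ (here {[]})         = there here
  insertMediants-adjacentʳ (here {_ ∷ _})      = there here
  insertMediants-adjacentʳ (there a@here)      = there (there (insertMediants-adjacentʳ a))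
  insertMediants-adjacentʳ (there a@(there _)) = there (there (insertMediants-adjacentʳ a))

det : ℚ → ℚ → ℤ
det p q = ↧ p ℤ.* ↥ q ℤ.- ↥ p ℤ.* ↧ q

det-self : ∀ p → det p p ≡ 0ℤ
det-self p = lemma (↥ p) (↧ p)
  where
  lemma : ∀ a b → b ℤ.* a ℤ.- a ℤ.* b ≡ 0ℤ
  lemma = solve-∀

det-antisym : ∀ p q → det q p ≡ ℤ.- det p q
det-antisym p q = lemma (↥ p) (↧ p) (↥ q) (↧ q)
  where
  lemma : ∀ a b c d → d ℤ.* a ℤ.- c ℤ.* b ≡ ℤ.- (b ℤ.* c ℤ.- a ℤ.* d)
  lemma = solve-∀

-- Equal cross products force equality because reduced forms are unique.
det≡0⇒≡ : ∀ p q → det p q ≡ 0ℤ → p ≡ q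
det≡0⇒≡ p q eq = ≃⇒≡ (*≡* (trans (sym (ℤ.i-j≡0⇒i≡j _ _ eq)) (ℤ.*-comm (↧ p) (↥ q))))

≤⇒det≡+ : ∀ {p q} → p ≤ q → + ∣ det p q ∣ ≡ det p q
≤⇒det≡+ {p} {q} p≤q = ℤ.0≤i⇒+∣i∣≡i (ℤ.i≤j⇒0≤j-i
  (subst (↥ p ℤ.* ↧ q ℤ.≤_) (ℤ.*-comm (↥ q) (↧ p)) (drop-*≤* p≤q)))

module _ (p q : ℚ) (det≡1 : det p q ≡ 1ℤ) where
  private
    m = mediant p q
    g = gcd (↥ p ℤ.+ ↥ q) (+ (↧ₙ p ℕ.+ ↧ₙ q))

    ↥m*g : ↥ m ℤ.* g ≡ ↥ p ℤ.+ ↥ q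
    ↥m*g = ↥-/ (↥ p ℤ.+ ↥ q) (↧ₙ p ℕ.+ ↧ₙ q)

    ↧m*g : ↧ m ℤ.* g ≡ ↧ p ℤ.+ ↧ q
    ↧m*g = ↧-/ (↥ p ℤ.+ ↥ q) (↧ₙ p ℕ.+ ↧ₙ q)

    -- Multiplying by `g` undoes the reduction of `m`. With the raw sums in place the contribution
    -- of `p` against itself cancels, leaving `det p q`; hence `g` divides 1.
    det*g≡1 : det p m ℤ.* g ≡ 1ℤ
    det*g≡1 = begin
      det p m ℤ.* g
        ≡⟨ distrib (↥ p) (↧ p) (↥ m) (↧ m) g ⟩
      ↧ p ℤ.* (↥ m ℤ.* g) ℤ.- ↥ p ℤ.* (↧ m ℤ.* g)
        ≡⟨ cong₂ (λ c d → ↧ p ℤ.* c ℤ.- ↥ p ℤ.* d) ↥m*g ↧m*g ⟩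
      ↧ p ℤ.* (↥ p ℤ.+ ↥ q) ℤ.- ↥ p ℤ.* (↧ p ℤ.+ ↧ q)
        ≡⟨ cancel (↥ p) (↧ p) (↥ q) (↧ q) ⟩
      det p q
        ≡⟨ det≡1 ⟩
      1ℤ ∎
      where
      open ≡-Reasoning
      distrib : ∀ a b c d k →
        (b ℤ.* c ℤ.- a ℤ.* d) ℤ.* k ≡ b ℤ.* (c ℤ.* k) ℤ.- a ℤ.* (d ℤ.* k)
      distrib = solve-∀
      cancel : ∀ a b c d →
        b ℤ.* (a ℤ.+ c) ℤ.- a ℤ.* (b ℤ.+ d) ≡ b ℤ.* c ℤ.- a ℤ.* d
      cancel = solve-∀

    g≡1 : g ≡ 1ℤ
    -- Absolute values suffice: a `gcd` is by definition the image of a natural number, which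
    -- excludes -1.
    g≡1 = cong +_ (ℕ.m*n≡1⇒n≡1 ∣ det p m ∣ ∣ g ∣
      (trans (sym (ℤ.abs-* (det p m) g)) (cong ∣_∣ det*g≡1)))

    *g : ∀ i → i ≡ i ℤ.* g
    *g i = sym (trans (cong (i ℤ.*_) g≡1) (ℤ.*-identityʳ i))

  ↥-mediant : ↥ mediant p q ≡ ↥ p ℤ.+ ↥ q
  ↥-mediant = trans (*g (↥ m)) ↥m*g

  ↧-mediant : ↧ mediant p q ≡ ↧ p ℤ.+ ↧ q
  ↧-mediant = trans (*g (↧ m)) ↧m*g

  -- `det` is bilinear in the vectors (numerator, denominator), and with no common factor removed
  -- the vector of the mediant is the sum of those of `p` and `q`.
  det-mediantʳ : ∀ x → det x (mediant p q) ≡ det x p ℤ.+ det x q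
  det-mediantʳ x = trans
    (cong₂ (λ c d → ↧ x ℤ.* c ℤ.- ↥ x ℤ.* d) ↥-mediant ↧-mediant)
    (lemma (↥ x) (↧ x) (↥ p) (↧ p) (↥ q) (↧ q))
    where
    lemma : ∀ e f a b c d → f ℤ.* (a ℤ.+ c) ℤ.- e ℤ.* (b ℤ.+ d)
      ≡ (f ℤ.* a ℤ.- e ℤ.* b) ℤ.+ (f ℤ.* c ℤ.- e ℤ.* d)
    lemma = solve-∀

  det-mediantˡ : ∀ x → det (mediant p q) x ≡ det p x ℤ.+ det q x
  det-mediantˡ x = begin
    det m x                           ≡⟨ det-antisym x m ⟩
    ℤ.- det x m                       ≡⟨ cong ℤ.-_ (det-mediantʳ x) ⟩
    ℤ.- (det x p ℤ.+ det x q)         ≡⟨ ℤ.neg-distrib-+ (det x p) (det x q) ⟩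
    ℤ.- det x p ℤ.+ ℤ.- det x q       ≡⟨ cong₂ ℤ._+_ (det-antisym x p) (det-antisym x q) ⟨
    det p x ℤ.+ det q x               ∎
    where open ≡-Reasoning

  det-left-mediant : det p (mediant p q) ≡ 1ℤ
  det-left-mediant = trans (det-mediantʳ p) (cong₂ ℤ._+_ (det-self p) det≡1)

  det-mediant-right : det (mediant p q) q ≡ 1ℤ
  det-mediant-right = trans (det-mediantˡ q) (cong₂ ℤ._+_ det≡1 (det-self q))

module _ (l r x : ℚ) where

  adjacent-appears : ∀ {p q} n → Adjacent p q (row l r n) → det p q ≡ 1ℤ →
    ∀ u v → det p x ≡ + u → det x q ≡ + v → Acc ℕ._<_ (u ℕ.+ v) →
    x AppearsIn T l r
  adjacent-appears {p} n a d zero v px xq _ =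
    n , subst (_∈ row l r n) (det≡0⇒≡ p x px) (adjacent⇒∈ˡ a)
  adjacent-appears {_} {q} n a d (suc u) zero px xq _ =
    n , subst (_∈ row l r n) (sym (det≡0⇒≡ x q xq)) (adjacent⇒∈ʳ a)
  adjacent-appears {p} {q} n a d u@(suc _) v@(suc _) px xq (acc rec) with ℕ.≤-total u v
  -- Here `det x m` is `v - u`, which is non-negative, so `x` lies in the left half. A tie also goes
  -- left, and then the next call finds `x` at the right endpoint.
  ... | inj₁ u≤v = adjacent-appears (suc n) (insertMediants-adjacentˡ a)
          (det-left-mediant p q d) u (v ℕ.∸ u) px x-mediant
          -- `z<s` is the positivity of `u`, which makes `v ∸ u` strictly smaller than `v`.
          (rec (ℕ.+-monoʳ-< u (ℕ.∸-monoʳ-< ℕ.z<s u≤v)))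
    where
    x-mediant : det x (mediant p q) ≡ + (v ℕ.∸ u)
    x-mediant = begin
      det x (mediant p q)    ≡⟨ det-mediantʳ p q d x ⟩
      det x p ℤ.+ det x q    ≡⟨ cong₂ ℤ._+_ (trans (det-antisym p x) (cong ℤ.-_ px)) xq ⟩
      -- As `u` is a successor, this sum computes to `v ⊖ u`.
      ℤ.- + u ℤ.+ + v        ≡⟨ ℤ.⊖-≥ u≤v ⟩
      + (v ℕ.∸ u)            ∎
      where open ≡-Reasoning
  ... | inj₂ v≤u = adjacent-appears (suc n) (insertMediants-adjacentʳ a)
          (det-mediant-right p q d) (u ℕ.∸ v) v mediant-x xq
          (rec (ℕ.+-monoˡ-< v (ℕ.∸-monoʳ-< ℕ.z<s v≤u)))
    where
    mediant-x : det (mediant p q) x ≡ + (u ℕ.∸ v)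
    mediant-x = begin
      det (mediant p q) x    ≡⟨ det-mediantˡ p q d x ⟩
      det p x ℤ.+ det q x    ≡⟨ cong₂ ℤ._+_ px (trans (det-antisym x q) (cong ℤ.-_ xq)) ⟩
      + u ℤ.+ ℤ.- + v        ≡⟨ ℤ.⊖-≥ v≤u ⟩
      + (u ℕ.∸ v)            ∎
      where open ≡-Reasoning

theorem3p1 : (l r : ℚ) → 0ℚ ≤ l → 0ℚ ≤ r →
    (↧ l) ℤ.* (↥ r) ℤ.- (↥ l) ℤ.* (↧ r) ≡ 1ℤ →
    (x : ℚ) → l ≤ x → x ≤ r → x AppearsIn T l r
theorem3p1 l r _ _ d x l≤x x≤r =
  -- The bounds on `x` make both determinants non-negative, so their absolute values can start the
  -- descent.
  adjacent-appears l r x 0 here d ∣ det l x ∣ ∣ det x r ∣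
    (sym (≤⇒det≡+ l≤x)) (sym (≤⇒det≡+ x≤r)) (<-wellFounded _)
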